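{- Let $n$ be a positive integer, let $\mathcal{D}_{(n)}$ be the set of all set systems with ground set $[n]$, and let $\mathcal{G}=\langle \ast,+\mid \ast^2,+^2,(\ast+)^3\rangle\cong S_3$. Define $\phi:S_n\to \operatorname{Aut}(\mathcal{G}^n)$ by $\phi(\pi)=\phi_\pi$, where $\phi_\pi(\hat g)=\hat g\pi^{ -1}$ for $\hat g\in\mathcal{G}^n$. Then $\phi$ is a group homomorphism, and the semidirect product $\mathcal{G}^n\rtimes_\phi S_n$, with multiplication $(\hat g,\pi_1)(\hat h,\pi_2)=(\hat g\circ \hat h\pi_1^{ -1},\pi_1\pi_2)$, acts (on the left) on $\mathcal{D}_{(n)}$ by $$(\hat g,\pi)D=\hat g\cdot(\pi D)=\hat g\cdot D_\pi=D_\pi\Gamma(\hat g).$$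
   Context: A set system with ground set $[n]=\{1,\dots,n\}$ is a pair $D=([n],\mathcal{F})$ with $\mathcal{F}$ any collection of subsets of $[n]$ (the feasible sets). For $i\in[n]$: the twist is $D\ast i=([n],\{X\triangle\{i\}: X\in\mathcal{F}\})$; the loop complementation is $D+i=([n],\mathcal{F}\triangle\{I\cup\{i\}: I\in\mathcal{F},\ i\notin I\})$. For fixed $i$ the operations $\ast i$ and $+i$ are involutions on set systems satisfying the relations of $\mathcal{G}$. For a word $g=g_1g_2\cdots g_k$ in $\{\ast,+\}$ put $D\,g\,i:=(\cdots(D\,g_k\,i)\,g_{k-1}\,i\cdots)\,g_1\,i$ (rightmost letter applied first); this depends only on the element $g\in\mathcal{G}$. Operations on distinct elements $i\ne j$ commute. An element $\hat g=(g_1,\dots,g_n)\in\mathcal{G}^n$ is viewed as a map $[n]\to\mathcal{G}$, $\hat g(i)=g_i$; multiplication $\circ$ in $\mathcal{G}^n$ is componentwise. $\hat g\cdot D=D\,\Gamma(\hat g)$ denotes the set system obtained from $D$ by applying $g_i$ to element $i$, for every $i\in[n]$ (in any order). For $\pi\in S_n$, $\pi D=D_\pi=([n],\{\pi(I): I\in\mathcal{F}\})$, and $\hat g\pi^{ -1}$ is the reindexing $(\hat g\pi^{ -1})(i)=g_{\pi^{ -1}(i)}$. Permutations are composed as functions. -}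

module Defs where

open import Level using (Level; _⊔_; 0ℓ)
open import Algebra.Bundles using (Group)
import Algebra.Construct.Pointwise as Pointwise
open import Algebra.Morphism.Structures using (module GroupMorphisms)
import Algebra.Morphism.Construct.Composition as Composition
import Algebra.Morphism.Construct.Identity as Identity
open import Data.Bool.Base using (Bool; true; _∧_; _xor_)
import Data.Bool.Properties as Bool
open import Data.Fin.Base using (Fin)
import Data.Fin.Properties as Fin
open import Data.Fin.Permutation as Perm
  using (Permutation′; _⟨$⟩ʳ_; _⟨$⟩ˡ_; _∘ₚ_)
open import Data.Fin.Subset using (Subset; ⁅_⁆; _∪_)
open import Data.Fin.Subset.Properties using (_∈?_; anySubset?)
open import Data.List.Base using (List; []; _∷_; _++_; [_]; reverse; foldr; foldl; allFin)
open import Data.List.Properties using (++-assoc; ++-identityʳ; unfold-reverse; reverse-involutive)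
open import Data.Nat.Base using (ℕ)
open import Data.Product.Base using (Σ; ∃; _×_; _,_; proj₁; proj₂)
open import Data.Vec.Base using (zipWith; tabulate)
open import Data.Vec.Properties using (≡-dec)
open import Function.Base using (_∘_)
open import Relation.Binary.Bundles using (Setoid)
open import Relation.Binary.PropositionalEquality
  using (_≡_; _→-setoid_; subst) renaming
  (refl to ≡-refl; sym to ≡-sym; trans to ≡-trans; cong to ≡-cong)
open import Relation.Nullary.Decidable using (does; _×-dec_; ¬?)

private
  variable
    c ℓ c₁ ℓ₁ c₂ ℓ₂ : Level
    n : ℕ

------------------------------------------------------------------------
-- Groups

IsHom : (G : Group c₁ ℓ₁) (H : Group c₂ ℓ₂) →
        (Group.Carrier G → Group.Carrier H) → Set (c₁ ⊔ ℓ₁ ⊔ ℓ₂)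
IsHom G H = GroupMorphisms.IsGroupHomomorphism (Group.rawGroup G) (Group.rawGroup H)

IsIso : (G : Group c₁ ℓ₁) (H : Group c₂ ℓ₂) →
        (Group.Carrier G → Group.Carrier H) → Set (c₁ ⊔ c₂ ⊔ ℓ₁ ⊔ ℓ₂)
IsIso G H = GroupMorphisms.IsGroupIsomorphism (Group.rawGroup G) (Group.rawGroup H)

infix 4 _≅_
_≅_ : Group c₁ ℓ₁ → Group c₂ ℓ₂ → Set (c₁ ⊔ c₂ ⊔ ℓ₁ ⊔ ℓ₂)
G ≅ H = ∃ (IsIso G H)

IsAutomorphism : (G : Group c ℓ) → (Group.Carrier G → Group.Carrier G) → Set (c ⊔ ℓ)
IsAutomorphism G = IsIso G G

-- Automorphisms are compared pointwise and composed as functions.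
Aut : Group c ℓ → Group (c ⊔ ℓ) (c ⊔ ℓ)
Aut G = record
  { Carrier = Σ (Carrier → Carrier) (IsAutomorphism G)
  ; _≈_     = λ f g → ∀ x → proj₁ f x ≈ proj₁ g x
  ; _∙_     = λ f g → proj₁ f ∘ proj₁ g
                    , Composition.isGroupIsomorphism trans (proj₂ g) (proj₂ f)
  ; ε       = (λ x → x) , Identity.isGroupIsomorphism rawGroup refl
  ; _⁻¹     = λ f → inv f , inv-iso f
  ; isGroup = record
    { isMonoid = record
      { isSemigroup = record
        { isMagma = record
          { isEquivalence = record
            { refl  = λ _ → refl
            ; sym   = λ p x → sym (p x)
            ; trans = λ p q x → trans (p x) (q x)
            }
          ; ∙-cong = λ {f} {g} {h} {k} p q x →
              trans (Iso.⟦⟧-cong (proj₂ f) (q x)) (p (proj₁ k x))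
          }
        ; assoc = λ _ _ _ _ → refl
        }
      ; identity = (λ _ _ → refl) , (λ _ _ → refl)
      }
    ; inverse = (λ f x → Iso.injective (proj₂ f) (inv-right f (proj₁ f x))) , inv-right
    ; ⁻¹-cong = λ {f} {g} p x → Iso.injective (proj₂ f)
        (trans (inv-right f x) (sym (trans (p (inv g x)) (inv-right g x))))
    }
  }
  where
  open Group G
  module Iso {f} (iso : IsAutomorphism G f) = GroupMorphisms.IsGroupIsomorphism iso


  inv : Σ (Carrier → Carrier) (IsAutomorphism G) → Carrier → Carrier
  inv (_ , iso) x = proj₁ (Iso.surjective iso x)

  inv-right : ∀ f x → proj₁ f (inv f x) ≈ x
  inv-right (_ , iso) x = proj₂ (Iso.surjective iso x) refl

  inv-iso : ∀ f → IsAutomorphism G (inv f)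
  inv-iso F@(f , iso) = record
    { isGroupMonomorphism = record
      { isGroupHomomorphism = record
        { isMonoidHomomorphism = record
          { isMagmaHomomorphism = record
            { isRelHomomorphism = record { cong = inv-cong }
            ; homo = λ x y → Iso.injective iso (trans (inv-right F (x ∙ y))
                (sym (trans (Iso.∙-homo iso _ _) (∙-cong (inv-right F x) (inv-right F y)))))
            }
          ; ε-homo = Iso.injective iso (trans (inv-right F ε) (sym (Iso.ε-homo iso)))
          }
        ; ⁻¹-homo = λ x → Iso.injective iso (trans (inv-right F (x ⁻¹))
            (sym (trans (Iso.⁻¹-homo iso _) (⁻¹-cong (inv-right F x)))))
        }
      ; injective = λ {x} {y} p →
          trans (sym (inv-right F x)) (trans (Iso.⟦⟧-cong iso p) (inv-right F y))
      }
    ; surjective = λ y → f y , λ {z} z≈fy →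
        Iso.injective iso (trans (inv-right F z) z≈fy)
    }
    where
    inv-cong : ∀ {x y} → x ≈ y → inv F x ≈ inv F y
    inv-cong {x} {y} p = Iso.injective iso
      (trans (inv-right F x) (trans p (sym (inv-right F y))))

-- Elements are pairs (n , h), multiplied by
-- (n₁ , h₁) (n₂ , h₂) = (n₁ ∙ φ h₁ n₂ , h₁ ∙ h₂).
semidirect : (N : Group c₁ ℓ₁) (H : Group c₂ ℓ₂)
             (φ : Group.Carrier H → Group.Carrier (Aut N)) →
             IsHom H (Aut N) φ → Group (c₁ ⊔ c₂) (ℓ₁ ⊔ ℓ₂)
semidirect N H φ φ-hom = record
  { Carrier = N.Carrier × H.Carrier
  ; _≈_     = λ (n₁ , h₁) (n₂ , h₂) → n₁ N.≈ n₂ × h₁ H.≈ h₂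
  ; _∙_     = λ (n₁ , h₁) (n₂ , h₂) → n₁ N.∙ φ· h₁ n₂ , h₁ H.∙ h₂
  ; ε       = N.ε , H.ε
  ; _⁻¹     = λ (n , h) → φ· (h H.⁻¹) (n N.⁻¹) , h H.⁻¹
  ; isGroup = record
    { isMonoid = record
      { isSemigroup = record
        { isMagma = record
          { isEquivalence = record
            { refl  = N.refl , H.refl
            ; sym   = λ (p , q) → N.sym p , H.sym q
            ; trans = λ (p , q) (p′ , q′) → N.trans p p′ , H.trans q q′
            }
          ; ∙-cong = λ (p , q) (p′ , q′) → N.∙-cong p (φ-cong q p′) , H.∙-cong q q′
          }
        ; assoc = λ (n₁ , h₁) (n₂ , h₂) (n₃ , h₃) →
            N.trans (N.∙-congˡ (φ-∙ h₁ h₂ n₃))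
              (N.trans (N.assoc _ _ _)
                (N.∙-congˡ (N.sym (φ-homo h₁ _ _))))
          , H.assoc h₁ h₂ h₃
        }
      ; identity =
          (λ (n , h) → N.trans (N.identityˡ _) (φ-ε n) , H.identityˡ h)
        , (λ (n , h) → N.trans (N.∙-congˡ (φ-1 h)) (N.identityʳ n) , H.identityʳ h)
      }
    ; inverse =
        (λ (n , h) →
            N.trans (N.sym (φ-homo (h H.⁻¹) _ _))
              (N.trans (φ-cong H.refl (N.inverseˡ n)) (φ-1 (h H.⁻¹)))
          , H.inverseˡ h)
      , (λ (n , h) →
            N.trans (N.∙-congˡ (N.trans (N.sym (φ-∙ h (h H.⁻¹) _))
              (N.trans (φ-cong (H.inverseʳ h) N.refl) (φ-ε _)))) (N.inverseʳ n)
          , H.inverseʳ h)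
    ; ⁻¹-cong = λ (p , q) → φ-cong (H.⁻¹-cong q) (N.⁻¹-cong p) , H.⁻¹-cong q
    }
  }
  where
  module N = Group N
  module H = Group H
  module Φ = GroupMorphisms.IsGroupHomomorphism φ-hom
  module Iso h = GroupMorphisms.IsGroupIsomorphism (proj₂ (φ h))

  φ· : H.Carrier → N.Carrier → N.Carrier
  φ· h = proj₁ (φ h)

  φ-cong : ∀ {h k x y} → h H.≈ k → x N.≈ y → φ· h x N.≈ φ· k y
  φ-cong {h} {k} {x} {y} p q = N.trans (Iso.⟦⟧-cong h q) (Φ.⟦⟧-cong p y)

  φ-∙ : ∀ h k x → φ· (h H.∙ k) x N.≈ φ· h (φ· k x)
  φ-∙ h k = Φ.homo h k

  φ-ε : ∀ x → φ· H.ε x N.≈ x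
  φ-ε = Φ.ε-homo

  φ-homo : ∀ h x y → φ· h (x N.∙ y) N.≈ φ· h x N.∙ φ· h y
  φ-homo h = Iso.∙-homo h

  φ-1 : ∀ h → φ· h N.ε N.≈ N.ε
  φ-1 h = Iso.ε-homo h

record IsLeftAction (G : Group c₁ ℓ₁) (X : Setoid c₂ ℓ₂)
    (_▷_ : Group.Carrier G → Setoid.Carrier X → Setoid.Carrier X) :
    Set (c₁ ⊔ ℓ₁ ⊔ c₂ ⊔ ℓ₂) where
  private
    module G = Group G
    module X = Setoid X
  field
    ▷-cong     : ∀ {g h x y} → g G.≈ h → x X.≈ y → (g ▷ x) X.≈ (h ▷ y)
    ▷-identity : ∀ x → (G.ε ▷ x) X.≈ x
    ▷-assoc    : ∀ g h x → ((g G.∙ h) ▷ x) X.≈ (g ▷ (h ▷ x))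

-- Permutations are composed as functions: (π ∙ ρ) i = π (ρ i), which is
-- the reverse of the diagrammatic order of _∘ₚ_.
Sym : ℕ → Group 0ℓ 0ℓ
Sym n = record
  { Carrier = Permutation′ n
  ; _≈_     = Perm._≈_
  ; _∙_     = λ π ρ → ρ ∘ₚ π
  ; ε       = Perm.id
  ; _⁻¹     = Perm.flip
  ; isGroup = record
    { isMonoid = record
      { isSemigroup = record
        { isMagma = record
          { isEquivalence = record
            { refl  = λ _ → ≡-refl
            ; sym   = λ p i → ≡-sym (p i)
            ; trans = λ p q i → ≡-trans (p i) (q i)
            }
          ; ∙-cong = λ {π} {π′} {ρ} {ρ′} p q i →
              ≡-trans (≡-cong (π ⟨$⟩ʳ_) (q i)) (p (ρ′ ⟨$⟩ʳ i))
          }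
        ; assoc = λ _ _ _ _ → ≡-refl
        }
      ; identity = (λ _ _ → ≡-refl) , (λ _ _ → ≡-refl)
      }
    ; inverse = (λ π _ → Perm.inverseˡ π) , (λ π _ → Perm.inverseʳ π)
    ; ⁻¹-cong = λ {π} {ρ} p i →
        ≡-trans (≡-cong (π ⟨$⟩ˡ_) (≡-sym (≡-trans (p (ρ ⟨$⟩ˡ i)) (Perm.inverseʳ ρ))))
                (Perm.inverseˡ π)
    }
  }

------------------------------------------------------------------------
-- The group ⟨ ∗ , ＋ ∣ ∗² , ＋² , (∗＋)³ ⟩

data Letter : Set where
  ∗ ＋ : Letter

Word : Set
Word = List Letter

-- Words g₁ ∷ g₂ ∷ … in the generators only: because of the relators ∗²
-- and ＋², formal inverses of the generators are not needed.
infix 4 _≈ʷ_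
data _≈ʷ_ : Word → Word → Set where
  ∗²      : ∗ ∷ ∗ ∷ [] ≈ʷ []
  ＋²      : ＋ ∷ ＋ ∷ [] ≈ʷ []
  ∗＋³     : ∗ ∷ ＋ ∷ ∗ ∷ ＋ ∷ ∗ ∷ ＋ ∷ [] ≈ʷ []
  refl    : ∀ {u} → u ≈ʷ u
  sym     : ∀ {u v} → u ≈ʷ v → v ≈ʷ u
  trans   : ∀ {u v w} → u ≈ʷ v → v ≈ʷ w → u ≈ʷ w
  ++-cong : ∀ {u u′ v v′} → u ≈ʷ u′ → v ≈ʷ v′ → u ++ v ≈ʷ u′ ++ v′

private
  reflexive : ∀ {u v} → u ≡ v → u ≈ʷ v
  reflexive ≡-refl = refl

  letter² : ∀ a → a ∷ a ∷ [] ≈ʷ []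
  letter² ∗ = ∗²
  letter² ＋ = ＋²

  reverse-inverseˡ : ∀ w → reverse w ++ w ≈ʷ []
  reverse-inverseˡ []      = refl
  reverse-inverseˡ (a ∷ w) = trans
    (reflexive (≡-trans (≡-cong (_++ a ∷ w) (unfold-reverse a w))
                        (++-assoc (reverse w) [ a ] (a ∷ w))))
    (trans (++-cong (refl {reverse w}) (++-cong (letter² a) (refl {w})))
           (reverse-inverseˡ w))

  reverse-inverseʳ : ∀ w → w ++ reverse w ≈ʷ []
  reverse-inverseʳ w =
    subst (λ v → v ++ reverse w ≈ʷ []) (reverse-involutive w)
          (reverse-inverseˡ (reverse w))

  reverse-cong : ∀ {u v} → u ≈ʷ v → reverse u ≈ʷ reverse v
  reverse-cong {u} {v} u≈v =
    trans (reflexive (≡-sym (++-identityʳ (reverse u))))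
    (trans (++-cong (refl {reverse u}) (sym (reverse-inverseʳ v)))
    (trans (reflexive (≡-sym (++-assoc (reverse u) v (reverse v))))
           (++-cong (trans (++-cong (refl {reverse u}) (sym u≈v)) (reverse-inverseˡ u))
                    (refl {reverse v}))))

𝓖 : Group 0ℓ 0ℓ
𝓖 = record
  { Carrier = Word
  ; _≈_     = _≈ʷ_
  ; _∙_     = _++_
  ; ε       = []
  ; _⁻¹     = reverse
  ; isGroup = record
    { isMonoid = record
      { isSemigroup = record
        { isMagma = record
          { isEquivalence = record { refl = refl ; sym = sym ; trans = trans }
          ; ∙-cong = ++-cong
          }
        ; assoc = λ u v w → reflexive (++-assoc u v w)
        }
      ; identity = (λ _ → refl) , (λ w → reflexive (++-identityʳ w))
      }
    ; inverse = reverse-inverseˡ , reverse-inverseʳ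
    ; ⁻¹-cong = reverse-cong
    }
  }

𝓖^ : ℕ → Group 0ℓ 0ℓ
𝓖^ n = Pointwise.group (Fin n) 𝓖

-- ĝ π⁻¹
reindex : Permutation′ n → (Fin n → Word) → (Fin n → Word)
reindex π ĝ i = ĝ (π ⟨$⟩ˡ i)

------------------------------------------------------------------------
-- Set systems

-- The ground set [n] is Fin n, and a collection of subsets is given by its
-- characteristic function, so that symmetric differences can be formed.
SetSystem : ℕ → Set
SetSystem n = Subset n → Bool

-- Equality of set systems is having the same feasible sets.
SetSystems : ℕ → Setoid 0ℓ 0ℓ
SetSystems n = Subset n →-setoid Bool

infixl 5 _△_ _△ˢ_
_△_ : Subset n → Subset n → Subset n
_△_ = zipWith _xor_

_△ˢ_ : SetSystem n → SetSystem n → SetSystem n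
(D △ˢ E) X = D X xor E X

-- { f X ∣ X feasible in D }
image : (Subset n → Subset n) → SetSystem n → SetSystem n
image f D Y = does (anySubset? λ X →
  (D X Bool.≟ true) ×-dec ≡-dec Bool._≟_ Y (f X))

-- { I ∣ I feasible in D , i ∉ I }
avoiding : Fin n → SetSystem n → SetSystem n
avoiding i D I = D I ∧ does (¬? (i ∈? I))

twist : SetSystem n → Fin n → SetSystem n
twist D i = image (_△ ⁅ i ⁆) D

loopComplementation : SetSystem n → Fin n → SetSystem n
loopComplementation D i = D △ˢ image (_∪ ⁅ i ⁆) (avoiding i D)

applyLetter : Letter → SetSystem n → Fin n → SetSystem n
applyLetter ∗ = twist
applyLetter ＋ = loopComplementation

-- The rightmost letter is applied first.
applyWord : Word → SetSystem n → Fin n → SetSystem n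
applyWord g D i = foldr (λ a E → applyLetter a E i) D g

-- D Γ(ĝ); operations on distinct elements commute, so the order in which
-- the elements are visited is immaterial.
infixl 5 _Γ_
_Γ_ : SetSystem n → (Fin n → Word) → SetSystem n
_Γ_ {n} D ĝ = foldl (λ E i → applyWord (ĝ i) E i) D (allFin n)

permuteSubset : Permutation′ n → Subset n → Subset n
permuteSubset π I = tabulate λ j →
  does (Fin.any? λ i → (i ∈? I) ×-dec (j Fin.≟ π ⟨$⟩ʳ i))

permute : Permutation′ n → SetSystem n → SetSystem n
permute π = image (permuteSubset π)

{-# OPTIONS --safe #-}
-- On the two values D (X \ i), D (X ∪ i) of a set system D, the letters act as
-- the elements (a , b) ↦ (b , a) and (a , b) ↦ (a , a + b) of GL₂(𝔽₂). Operations
-- on distinct elements of the ground set act on distinct tensor factors, hence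
-- commute, and relabelling the ground set by π carries an operation on i to one
-- on π(i). For 𝓖 ≅ S₃, every word equals one of six normal forms, and a normal
-- form is determined by the images of 0 and 1 under the permutation it represents.
module Submission where

open import Defs
open import Data.Nat.Base using (ℕ; NonZero)
open import Data.Product.Base using (_×_; _,_; Σ-syntax)
open import Data.Fin.Permutation using (Permutation′)

open import Algebra.Bundles using (Group)
import Algebra.Properties.Group as GroupProperties
open import Data.Bool.Base using (Bool; true; false; not; _∧_; _xor_)
import Data.Bool.Properties as Bool
open import Data.Bool.Solver using (module xor-∧-Solver)
open import Data.Empty using (⊥-elim)
open import Data.Fin.Base using (Fin)
open import Data.Fin.Patterns using (0F; 1F; 2F)
import Data.Fin.Properties as Fin
open import Data.Fin.Permutation as Perm
  using (_⟨$⟩ʳ_; _⟨$⟩ˡ_; _∘ₚ_; transpose)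
open import Data.Fin.Subset using (Subset; ⁅_⁆; _∪_)
open import Data.Fin.Subset.Properties using (_∈?_; anySubset?; ∪-identityʳ)
open import Data.List.Base using (List; []; _∷_; _++_; foldr; foldl; map; allFin; reverse)
open import Data.List.Membership.Propositional using (_∈_)
open import Data.List.Membership.Propositional.Properties using (∈-allFin; ∈-map⁺)
open import Data.List.Membership.Propositional.Properties.WithK using (unique∧set⇒bag)
open import Data.List.Properties using (foldr-++)
open import Data.List.Relation.Binary.BagAndSetEquality using (∼bag⇒↭)
open import Data.List.Relation.Binary.Permutation.Propositional as ↭ using (_↭_)
open import Data.List.Relation.Unary.All using (All; []; _∷_)
open import Data.List.Relation.Unary.AllPairs using ([]; _∷_)
open import Data.List.Relation.Unary.Unique.Propositional using (Unique)
open import Data.List.Relation.Unary.Unique.Propositional.Properties using (allFin⁺; map⁺)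
open import Data.Product.Base using (∃)
open import Data.Vec.Base using ([]; _∷_; lookup; tabulate; _[_]≔_)
open import Data.Vec.Properties
  using ( []=⇒lookup; lookup⇒[]=; lookup∘update; lookup∘update′; []≔-commutes
        ; []≔-idempotent; []≔-lookup; lookup∘tabulate; tabulate∘lookup; tabulate-cong
        ; zipWith-identityʳ)
open import Function.Base using (_∘_)
open import Function.Bundles using (mk⇔)
open import Relation.Binary.PropositionalEquality as ≡
  using (_≡_; _≢_; _≗_; cong; cong₂; subst; module ≡-Reasoning)
import Relation.Binary.Reasoning.Setoid as SetoidReasoning
open import Relation.Nullary.Decidable using (Dec; yes; no; does; ¬?; _→-dec_; from-yes)

private
  variable
    n : ℕ

open xor-∧-Solver using (solve; con; _:+_; _:*_; _:=_)

module 𝓖 = Group 𝓖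

-- 𝓖 ≅ S₃

module Sym3 = Group (Sym 3)

-- Adjacent transpositions, the Coxeter generators of S₃: they are involutions whose product is a
-- 3-cycle, as the three relators demand.
letterPerm : Letter → Permutation′ 3
letterPerm ∗ = transpose 0F 1F
letterPerm ＋ = transpose 1F 2F

wordPerm : Word → Permutation′ 3
wordPerm = foldr (λ a π → letterPerm a Sym3.∙ π) Sym3.ε

wordPerm-++ : ∀ u v → wordPerm (u ++ v) Sym3.≈ wordPerm u Sym3.∙ wordPerm v
wordPerm-++ []      v i = ≡.refl
wordPerm-++ (a ∷ u) v i = cong (letterPerm a ⟨$⟩ʳ_) (wordPerm-++ u v i)

wordPerm-cong : ∀ {u v} → u ≈ʷ v → wordPerm u Sym3.≈ wordPerm v
wordPerm-cong ∗² 0F = ≡.refl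
wordPerm-cong ∗² 1F = ≡.refl
wordPerm-cong ∗² 2F = ≡.refl
wordPerm-cong ＋² 0F = ≡.refl
wordPerm-cong ＋² 1F = ≡.refl
wordPerm-cong ＋² 2F = ≡.refl
wordPerm-cong ∗＋³ 0F = ≡.refl
wordPerm-cong ∗＋³ 1F = ≡.refl
wordPerm-cong ∗＋³ 2F = ≡.refl
wordPerm-cong refl i = ≡.refl
wordPerm-cong (sym p) i = ≡.sym (wordPerm-cong p i)
wordPerm-cong (trans p q) i = ≡.trans (wordPerm-cong p i) (wordPerm-cong q i)
wordPerm-cong (++-cong {u} {u′} {v} {v′} p q) i = begin
  wordPerm (u ++ v) ⟨$⟩ʳ i                ≡⟨ wordPerm-++ u v i ⟩
  wordPerm u ⟨$⟩ʳ (wordPerm v ⟨$⟩ʳ i)     ≡⟨ wordPerm-cong p _ ⟩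
  wordPerm u′ ⟨$⟩ʳ (wordPerm v ⟨$⟩ʳ i)    ≡⟨ cong (wordPerm u′ ⟨$⟩ʳ_) (wordPerm-cong q i) ⟩
  wordPerm u′ ⟨$⟩ʳ (wordPerm v′ ⟨$⟩ʳ i)   ≡⟨ wordPerm-++ u′ v′ i ⟨
  wordPerm (u′ ++ v′) ⟨$⟩ʳ i              ∎
  where open ≡-Reasoning

wordPerm-reverse : ∀ w → wordPerm (reverse w) Sym3.≈ wordPerm w Sym3.⁻¹
wordPerm-reverse w =
  GroupProperties.inverseˡ-unique (Sym 3) (wordPerm (reverse w)) (wordPerm w)
    λ i → ≡.trans (≡.sym (wordPerm-++ (reverse w) w i)) (wordPerm-cong (𝓖.inverseˡ w) i)

-- The normal form representing 0 ↦ i , 1 ↦ j; junk if i ≡ j.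
normalForm : Fin 3 → Fin 3 → Word
normalForm 0F 1F = []
normalForm 1F 0F = ∗ ∷ []
normalForm 0F 2F = ＋ ∷ []
normalForm 1F 2F = ∗ ∷ ＋ ∷ []
normalForm 2F 0F = ＋ ∷ ∗ ∷ []
normalForm 2F 1F = ∗ ∷ ＋ ∷ ∗ ∷ []
normalForm _  _  = []

cancel : ∀ a w → a ∷ a ∷ w ≈ʷ w
cancel ∗ w = ++-cong ∗² (refl {w})
cancel ＋ w = ++-cong ＋² (refl {w})

-- `∗＋³` makes these two words mutually inverse. Each is a palindrome, hence its own `reverse`, so
-- uniqueness of inverses identifies them.
braid : ＋ ∷ ∗ ∷ ＋ ∷ [] ≈ʷ ∗ ∷ ＋ ∷ ∗ ∷ []
braid = sym (GroupProperties.inverseˡ-unique 𝓖 (∗ ∷ ＋ ∷ ∗ ∷ []) (＋ ∷ ∗ ∷ ＋ ∷ []) ∗＋³)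

-- The Cayley graph of S₃, edge by edge: most edges extend or cancel the leading letter, and only
-- the edge joining `∗ ∷ ＋ ∷ []` and `∗ ∷ ＋ ∷ ∗ ∷ []` needs `braid`. The hypothesis excludes the
-- junk values.
∷-normalForm : ∀ a {i j} → i ≢ j →
  a ∷ normalForm i j ≈ʷ normalForm (letterPerm a ⟨$⟩ʳ i) (letterPerm a ⟨$⟩ʳ j)
∷-normalForm a {0F} {0F} i≢j = ⊥-elim (i≢j ≡.refl)
∷-normalForm a {1F} {1F} i≢j = ⊥-elim (i≢j ≡.refl)
∷-normalForm a {2F} {2F} i≢j = ⊥-elim (i≢j ≡.refl)
∷-normalForm ∗ {0F} {1F} _ = refl
∷-normalForm ∗ {1F} {0F} _ = cancel ∗ _
∷-normalForm ∗ {0F} {2F} _ = refl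
∷-normalForm ∗ {1F} {2F} _ = cancel ∗ _
∷-normalForm ∗ {2F} {0F} _ = refl
∷-normalForm ∗ {2F} {1F} _ = cancel ∗ _
∷-normalForm ＋ {0F} {1F} _ = refl
∷-normalForm ＋ {1F} {0F} _ = refl
∷-normalForm ＋ {0F} {2F} _ = cancel ＋ _
∷-normalForm ＋ {1F} {2F} _ = braid
∷-normalForm ＋ {2F} {0F} _ = cancel ＋ _
∷-normalForm ＋ {2F} {1F} _ = trans (++-cong (refl {＋ ∷ []}) (sym braid)) (cancel ＋ _)

permWord : Permutation′ 3 → Word
permWord π = normalForm (π ⟨$⟩ʳ 0F) (π ⟨$⟩ʳ 1F)

perm-injective : (π : Permutation′ n) → ∀ {i j} → π ⟨$⟩ʳ i ≡ π ⟨$⟩ʳ j → i ≡ j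
perm-injective π p = ≡.trans (≡.sym (Perm.inverseˡ π)) (≡.trans (cong (π ⟨$⟩ˡ_) p) (Perm.inverseˡ π))

-- Source of injectivity: the permutation alone recovers the word up to `≈ʷ`, by normalising the
-- tail and then absorbing one letter.
permWord-wordPerm : ∀ w → w ≈ʷ permWord (wordPerm w)
permWord-wordPerm []      = refl
permWord-wordPerm (a ∷ w) = trans (++-cong (refl {a ∷ []}) (permWord-wordPerm w))
  (∷-normalForm a λ p → 0≢1 (perm-injective (wordPerm w) p))
  where
  0≢1 : _≢_ {A = Fin 3} 0F 1F
  0≢1 ()

-- Everything ranges over `Fin 3`, so the claim is settled by evaluating its decision procedure. The
-- third image `k` is a variable so that the value at 2 can be stated.
wordPerm-normalForm : ∀ i j k → i ≢ j → i ≢ k → j ≢ k →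
  ∀ l → wordPerm (normalForm i j) ⟨$⟩ʳ l ≡ lookup (i ∷ j ∷ k ∷ []) l
wordPerm-normalForm = from-yes (Fin.all? λ i → Fin.all? λ j → Fin.all? λ k →
  ¬? (i Fin.≟ j) →-dec ¬? (i Fin.≟ k) →-dec ¬? (j Fin.≟ k) →-dec
  Fin.all? λ l → wordPerm (normalForm i j) ⟨$⟩ʳ l Fin.≟ lookup (i ∷ j ∷ k ∷ []) l)

wordPerm-permWord : ∀ π → wordPerm (permWord π) Sym3.≈ π
wordPerm-permWord π = λ where
    0F → values 0F
    1F → values 1F
    2F → values 2F
  where
  distinct : ∀ {i j} → i ≢ j → π ⟨$⟩ʳ i ≢ π ⟨$⟩ʳ j
  distinct i≢j p = i≢j (perm-injective π p)

  values = wordPerm-normalForm (π ⟨$⟩ʳ 0F) (π ⟨$⟩ʳ 1F) (π ⟨$⟩ʳ 2F)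
    (distinct λ ()) (distinct λ ()) (distinct λ ())

permWord-cong : ∀ {π ρ} → π Sym3.≈ ρ → permWord π ≡ permWord ρ
permWord-cong p = cong₂ normalForm (p 0F) (p 1F)

wordPerm-isIso : IsIso 𝓖 (Sym 3) wordPerm
wordPerm-isIso = record
  { isGroupMonomorphism = record
    { isGroupHomomorphism = record
      { isMonoidHomomorphism = record
        { isMagmaHomomorphism = record
          { isRelHomomorphism = record { cong = wordPerm-cong }
          ; homo = wordPerm-++
          }
        ; ε-homo = λ _ → ≡.refl
        }
      ; ⁻¹-homo = wordPerm-reverse
      }
    ; injective = λ {u} {v} p → 𝓖.trans (permWord-wordPerm u)
        (𝓖.trans (𝓖.reflexive (permWord-cong {wordPerm u} {wordPerm v} p)) (𝓖.sym (permWord-wordPerm v)))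
    }
  ; surjective = λ π → permWord π , λ z≈ i → ≡.trans (wordPerm-cong z≈ i) (wordPerm-permWord π i)
  }

-- The homomorphism φ

reindex-isAutomorphism : (π : Permutation′ n) → IsAutomorphism (𝓖^ n) (reindex π)
reindex-isAutomorphism π = record
  { isGroupMonomorphism = record
    { isGroupHomomorphism = record
      { isMonoidHomomorphism = record
        { isMagmaHomomorphism = record
          { isRelHomomorphism = record { cong = λ p i → p (π ⟨$⟩ˡ i) }
          ; homo = λ _ _ _ → refl
          }
        ; ε-homo = λ _ → refl
        }
      ; ⁻¹-homo = λ _ _ → refl
      }
    ; injective = λ {ĝ} {ĥ} p i →
        subst (λ j → ĝ j ≈ʷ ĥ j) (Perm.inverseˡ π) (p (π ⟨$⟩ʳ i))
    }
  -- `Aut` builds its inverses from this witness. Choosing reindexing by the inverse of `π` makes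
  -- `⁻¹-homo` of φ hold by computation.
  ; surjective = λ ĝ → ĝ ∘ (π ⟨$⟩ʳ_) , λ {ĥ} p i →
      subst (λ j → ĥ (π ⟨$⟩ˡ i) ≈ʷ ĝ j) (Perm.inverseʳ π) (p (π ⟨$⟩ˡ i))
  }

-- Precomposition and inversion each reverse products. The two reversals cancel, so φ preserves the
-- order of composition.
reindex-isHom : IsHom (Sym n) (Aut (𝓖^ n)) (λ π → reindex π , reindex-isAutomorphism π)
reindex-isHom {n} = record
  { isMonoidHomomorphism = record
    { isMagmaHomomorphism = record
      { isRelHomomorphism = record
        { cong = λ {π} {ρ} p ĝ i → 𝓖.reflexive (cong ĝ (Group.⁻¹-cong (Sym n) {π} {ρ} p i)) }
      ; homo = λ _ _ _ _ → refl
      }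
    ; ε-homo = λ _ _ → refl
    }
  ; ⁻¹-homo = λ _ _ _ → refl
  }

-- Images of set systems

-- Replaces the decision procedures inside `image`, `permuteSubset` and membership tests by explicit
-- Boolean expressions.
does≡ : ∀ {p} {P : Set p} (P? : Dec P) {b} → (P → b ≡ true) → (b ≡ true → P) → does P? ≡ b
does≡ (yes p)         to from = ≡.sym (to p)
does≡ (no ¬p) {false} to from = ≡.refl
does≡ (no ¬p) {true}  to from = ⊥-elim (¬p (from ≡.refl))

image≡ : ∀ (f : Subset n → Subset n) D Y {b} →
  (∀ X → D X ≡ true → Y ≡ f X → b ≡ true) →
  (b ≡ true → ∃ λ X → D X ≡ true × Y ≡ f X) →
  image f D Y ≡ b
image≡ f D Y to from = does≡ (anySubset? _) (λ (X , p , q) → to X p q) from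

-- For characteristic functions, an image under a bijection is precomposition with its inverse;
-- `twist` and `permute` are both of this kind.
image-bijection : ∀ {f g : Subset n → Subset n} →
  (∀ X → g (f X) ≡ X) → (∀ X → f (g X) ≡ X) → ∀ D → image f D ≗ D ∘ g
image-bijection {f = f} {g} gf fg D Y = image≡ f D Y
  (λ { X p ≡.refl → ≡.trans (cong D (gf X)) p })
  (λ p → g Y , p , ≡.sym (fg Y))

△-⁅⁆ : ∀ (X : Subset n) i → X △ ⁅ i ⁆ ≡ X [ i ]≔ not (lookup X i)
△-⁅⁆ (x ∷ X) Fin.zero    = cong₂ _∷_ (Bool.xor-comm x true) (zipWith-identityʳ Bool.xor-identityʳ X)
△-⁅⁆ (x ∷ X) (Fin.suc i) = cong₂ _∷_ (Bool.xor-identityʳ x) (△-⁅⁆ X i)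

△-cancelʳ : ∀ (Y X : Subset n) → X △ Y △ Y ≡ X
△-cancelʳ []      []      = ≡.refl
△-cancelʳ (y ∷ Y) (x ∷ X) = cong₂ _∷_
  (≡.trans (Bool.xor-assoc x y y) (≡.trans (cong (x xor_) (Bool.xor-same y)) (Bool.xor-identityʳ x)))
  (△-cancelʳ Y X)

∪-⁅⁆ : ∀ (X : Subset n) i → X ∪ ⁅ i ⁆ ≡ X [ i ]≔ true
∪-⁅⁆ (x ∷ X) Fin.zero    = cong₂ _∷_ (Bool.∨-zeroʳ x) (∪-identityʳ X)
∪-⁅⁆ (x ∷ X) (Fin.suc i) = cong₂ _∷_ (Bool.∨-identityʳ x) (∪-⁅⁆ X i)

does-∈? : ∀ i (X : Subset n) → does (i ∈? X) ≡ lookup X i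
does-∈? i X = does≡ (i ∈? X) []=⇒lookup (lookup⇒[]= i X)

twist≗ : ∀ D (i : Fin n) X → twist D i X ≡ D (X [ i ]≔ not (lookup X i))
twist≗ D i X = ≡.trans
  (image-bijection (△-cancelʳ ⁅ i ⁆) (△-cancelʳ ⁅ i ⁆) D X) (cong D (△-⁅⁆ X i))

[]≔-reset : ∀ (X : Subset n) i {b c} → lookup X i ≡ c → (X [ i ]≔ b) [ i ]≔ c ≡ X
[]≔-reset X i ≡.refl = ≡.trans ([]≔-idempotent X i) ([]≔-lookup X i)

avoiding≗ : ∀ (i : Fin n) D X → avoiding i D X ≡ D X ∧ not (lookup X i)
avoiding≗ i D X = cong (λ b → D X ∧ not b) (does-∈? i X)

-- Adding `i` is not a bijection on all subsets, but among subsets avoiding `i` the only possible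
-- preimage of `Y` is `Y` with `i` removed.
avoiding-∪ : ∀ (i : Fin n) D Y →
  image (_∪ ⁅ i ⁆) (avoiding i D) Y ≡ lookup Y i ∧ D (Y [ i ]≔ false)
avoiding-∪ i D Y = image≡ (_∪ ⁅ i ⁆) (avoiding i D) Y to from
  where
  open ≡-Reasoning

  to : ∀ X → avoiding i D X ≡ true → Y ≡ X ∪ ⁅ i ⁆ → lookup Y i ∧ D (Y [ i ]≔ false) ≡ true
  to X p ≡.refl = begin
    lookup (X ∪ ⁅ i ⁆) i ∧ D ((X ∪ ⁅ i ⁆) [ i ]≔ false)
      ≡⟨ cong (λ Z → lookup Z i ∧ D (Z [ i ]≔ false)) (∪-⁅⁆ X i) ⟩
    lookup (X [ i ]≔ true) i ∧ D ((X [ i ]≔ true) [ i ]≔ false)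
      ≡⟨ cong₂ (λ b Z → b ∧ D Z) (lookup∘update i X true) ([]≔-reset X i i∉X) ⟩
    D X
      ≡⟨ Bool.∧-conicalˡ _ _ X∈D,i∉X ⟩
    true ∎
    where
    X∈D,i∉X = ≡.trans (≡.sym (avoiding≗ i D X)) p
    i∉X     = Bool.not-injective (Bool.∧-conicalʳ (D X) _ X∈D,i∉X)

  from : lookup Y i ∧ D (Y [ i ]≔ false) ≡ true →
    ∃ λ X → avoiding i D X ≡ true × Y ≡ X ∪ ⁅ i ⁆
  from p = X
    , (begin
        avoiding i D X           ≡⟨ avoiding≗ i D X ⟩
        D X ∧ not (lookup X i)   ≡⟨ cong₂ (λ b c → b ∧ not c) (Bool.∧-conicalʳ _ _ p) (lookup∘update i Y false) ⟩
        true                     ∎)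
    , (begin
        Y                        ≡⟨ []≔-reset Y i (Bool.∧-conicalˡ _ _ p) ⟨
        X [ i ]≔ true            ≡⟨ ∪-⁅⁆ X i ⟨
        X ∪ ⁅ i ⁆                ∎)
    where
    X = Y [ i ]≔ false

-- The action of words on one coordinate

-- The arguments `false` and `true` stand for the element being absent and present. The `＋` clause
-- is polynomial over 𝔽₂ instead of a case split: this matches `avoiding-∪` and suits the ring
-- solver.
actLetter : Letter → (Bool → Bool) → (Bool → Bool)
actLetter ∗ v b = v (not b)
actLetter ＋ v b = v b xor (b ∧ v false)

actWord : Word → (Bool → Bool) → (Bool → Bool)
actWord w v = foldr actLetter v w

slice : SetSystem n → Subset n → Fin n → (Bool → Bool)
slice D X i b = D (X [ i ]≔ b)

actLetter-cong : ∀ a {v v′} → v ≗ v′ → actLetter a v ≗ actLetter a v′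
actLetter-cong ∗ p b = p (not b)
actLetter-cong ＋ p b = cong₂ (λ x y → x xor (b ∧ y)) (p b) (p false)

actWord-cong : ∀ w {v v′} → v ≗ v′ → actWord w v ≗ actWord w v′
actWord-cong []      p = p
actWord-cong (a ∷ w) p = actLetter-cong a (actWord-cong w p)

actWord-++ : ∀ u w v → actWord (u ++ w) v ≡ actWord u (actWord w v)
actWord-++ u w v = foldr-++ actLetter v u w

actWord-≈ : ∀ {u w} → u ≈ʷ w → ∀ v → actWord u v ≗ actWord w v
actWord-≈ ∗² v b = cong v (Bool.not-involutive b)
actWord-≈ ＋² v b = solve 3
  -- `con false` is what `false ∧ v false` reduces to: `＋` fixes the value at `false`.
  (λ b x y → (y :+ b :* x) :+ b :* (x :+ con false) := y) ≡.refl b (v false) (v b)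
-- Splitting on the argument evaluates every negation coming from `∗` and leaves a linear identity
-- in the two values of `v`.
actWord-≈ ∗＋³ v false = solve 2
  (λ x y → ((y :+ x) :+ con false) :+ ((x :+ con false) :+ (y :+ x)) := x)
  ≡.refl (v false) (v true)
actWord-≈ ∗＋³ v true  = solve 2
  (λ x y → ((x :+ con false) :+ (y :+ x)) :+ con false := y)
  ≡.refl (v false) (v true)
actWord-≈ refl v b = ≡.refl
actWord-≈ (sym p) v b = ≡.sym (actWord-≈ p v b)
actWord-≈ (trans p q) v b = ≡.trans (actWord-≈ p v b) (actWord-≈ q v b)
actWord-≈ (++-cong {u} {u′} {w} {w′} p q) v b = begin
  actWord (u ++ w) v b         ≡⟨ cong (λ f → f b) (actWord-++ u w v) ⟩
  actWord u (actWord w v) b    ≡⟨ actWord-≈ p (actWord w v) b ⟩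
  actWord u′ (actWord w v) b   ≡⟨ actWord-cong u′ (actWord-≈ q v) b ⟩
  actWord u′ (actWord w′ v) b  ≡⟨ cong (λ f → f b) (actWord-++ u′ w′ v) ⟨
  actWord (u′ ++ w′) v b       ∎
  where open ≡-Reasoning

actLetter-comm : ∀ a b (M : Bool → Bool → Bool) x y →
  actLetter a (λ x → actLetter b (M x) y) x ≡ actLetter b (λ y → actLetter a (λ x → M x y) x) y
actLetter-comm ∗ ∗ M x y = ≡.refl
actLetter-comm ∗ ＋ M x y = ≡.refl
actLetter-comm ＋ ∗ M x y = ≡.refl
-- Subscript 1 means the coordinate keeps its value `x` or `y`; subscript 0 means it is set to
-- `false`.
actLetter-comm ＋ ＋ M x y = solve 6
  (λ x y m₀₀ m₀₁ m₁₀ m₁₁ →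
    (m₁₁ :+ y :* m₁₀) :+ x :* (m₀₁ :+ y :* m₀₀) := (m₁₁ :+ x :* m₀₁) :+ y :* (m₁₀ :+ x :* m₀₀))
  ≡.refl x y (M false false) (M false y) (M x false) (M x y)

actLetter-actWord-comm : ∀ a w (M : Bool → Bool → Bool) x y →
  actLetter a (λ x → actWord w (M x) y) x ≡ actWord w (λ y → actLetter a (λ x → M x y) x) y
actLetter-actWord-comm a []      M x y = ≡.refl
actLetter-actWord-comm a (b ∷ w) M x y = ≡.trans
  (actLetter-comm a b (λ x → actWord w (M x)) x y)
  (actLetter-cong b (λ y → actLetter-actWord-comm a w M x y) y)

actWord-comm : ∀ u w (M : Bool → Bool → Bool) x y →
  actWord u (λ x → actWord w (M x) y) x ≡ actWord w (λ y → actWord u (λ x → M x y) x) y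
actWord-comm []      w M x y = ≡.refl
actWord-comm (a ∷ u) w M x y = ≡.trans
  (actLetter-cong a (λ x → actWord-comm u w M x y) x)
  (actLetter-actWord-comm a w (λ x y → actWord u (λ x → M x y) x) x y)

-- Operations on set systems at single elements

applyLetter≗ : ∀ a D (i : Fin n) X → applyLetter a D i X ≡ actLetter a (slice D X i) (lookup X i)
applyLetter≗ ∗ D i X = twist≗ D i X
applyLetter≗ ＋ D i X = cong₂ _xor_ (cong D (≡.sym ([]≔-lookup X i))) (avoiding-∪ i D X)

-- An operation at `i` only mixes the two subsets agreeing with `X` off `i`. The outer letter reads
-- the inner system on both, so the induction hypothesis is used on the whole slice.
applyWord≗ : ∀ w D (i : Fin n) X → applyWord w D i X ≡ actWord w (slice D X i) (lookup X i)
applyWord≗ []      D i X = cong D (≡.sym ([]≔-lookup X i))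
applyWord≗ (a ∷ w) D i X = begin
  applyLetter a (applyWord w D i) i X               ≡⟨ applyLetter≗ a (applyWord w D i) i X ⟩
  actLetter a (slice (applyWord w D i) X i) x       ≡⟨ actLetter-cong a slice-applyWord x ⟩
  actLetter a (actWord w (slice D X i)) x           ∎
  where
  open ≡-Reasoning
  x = lookup X i

  slice-applyWord : slice (applyWord w D i) X i ≗ actWord w (slice D X i)
  slice-applyWord b = begin
    applyWord w D i (X [ i ]≔ b)
      ≡⟨ applyWord≗ w D i (X [ i ]≔ b) ⟩
    actWord w (slice D (X [ i ]≔ b) i) (lookup (X [ i ]≔ b) i)
      ≡⟨ actWord-cong w (λ c → cong D ([]≔-idempotent X i)) _ ⟩
    actWord w (slice D X i) (lookup (X [ i ]≔ b) i)
      ≡⟨ cong (actWord w (slice D X i)) (lookup∘update i X b) ⟩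
    actWord w (slice D X i) b ∎

-- Operations at one element are thereby well defined on 𝓖: the relators were verified on slices.
applyWord-cong : ∀ {u w D E} → u ≈ʷ w → D ≗ E → ∀ (i : Fin n) → applyWord u D i ≗ applyWord w E i
applyWord-cong {u = u} {w} {D} {E} u≈w D≗E i X = begin
  applyWord u D i X                        ≡⟨ applyWord≗ u D i X ⟩
  actWord u (slice D X i) (lookup X i)     ≡⟨ actWord-cong u (λ b → D≗E (X [ i ]≔ b)) _ ⟩
  actWord u (slice E X i) (lookup X i)     ≡⟨ actWord-≈ u≈w _ _ ⟩
  actWord w (slice E X i) (lookup X i)     ≡⟨ applyWord≗ w E i X ⟨
  applyWord w E i X                        ∎
  where open ≡-Reasoning

applyWord-++ : ∀ u w D (i : Fin n) → applyWord (u ++ w) D i ≡ applyWord u (applyWord w D i) i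
applyWord-++ u w D i = foldr-++ (λ a E → applyLetter a E i) D u w

-- Brings nested operations into the two-variable form of `actWord-comm`. Distinctness ensures that
-- changing the bit at `i` leaves the bit at `j` alone.
applyWord-applyWord : ∀ u w D {i j : Fin n} → i ≢ j → ∀ X →
  applyWord u (applyWord w D j) i X ≡
  actWord u (λ x → actWord w (λ y → D (X [ i ]≔ x [ j ]≔ y)) (lookup X j)) (lookup X i)
applyWord-applyWord u w D {i} {j} i≢j X = ≡.trans (applyWord≗ u _ i X)
  (actWord-cong u (λ x → ≡.trans (applyWord≗ w D j (X [ i ]≔ x))
    (cong (actWord w _) (lookup∘update′ (i≢j ∘ ≡.sym) X x))) (lookup X i))

applyWord-comm : ∀ u w D {i j : Fin n} → i ≢ j →
  applyWord u (applyWord w D j) i ≗ applyWord w (applyWord u D i) j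
applyWord-comm u w D {i} {j} i≢j X = begin
  applyWord u (applyWord w D j) i X
    ≡⟨ applyWord-applyWord u w D i≢j X ⟩
  actWord u (λ x → actWord w (λ y → D (X [ i ]≔ x [ j ]≔ y)) (lookup X j)) (lookup X i)
    ≡⟨ actWord-comm u w (λ x y → D (X [ i ]≔ x [ j ]≔ y)) (lookup X i) (lookup X j) ⟩
  actWord w (λ y → actWord u (λ x → D (X [ i ]≔ x [ j ]≔ y)) (lookup X i)) (lookup X j)
    ≡⟨ actWord-cong w (λ y → actWord-cong u (λ x → cong D ([]≔-commutes X i j i≢j)) _) _ ⟩
  actWord w (λ y → actWord u (λ x → D (X [ j ]≔ y [ i ]≔ x)) (lookup X i)) (lookup X j)
    ≡⟨ applyWord-applyWord w u D (i≢j ∘ ≡.sym) X ⟨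
  applyWord w (applyWord u D i) j X ∎
  where open ≡-Reasoning

-- The action of 𝓖ⁿ

infixl 5 _Γ[_]_
-- `_Γ_` with an arbitrary visiting list, which permits induction on the list and comparison of
-- visiting orders.
_Γ[_]_ : SetSystem n → List (Fin n) → (Fin n → Word) → SetSystem n
D Γ[ is ] ĝ = foldl (λ E i → applyWord (ĝ i) E i) D is

Γ-cong : ∀ is {D E : SetSystem n} {ĝ ĥ} → (∀ i → ĝ i ≈ʷ ĥ i) → D ≗ E → D Γ[ is ] ĝ ≗ E Γ[ is ] ĥ
Γ-cong []       p D≗E = D≗E
Γ-cong (i ∷ is) {ĝ = ĝ} {ĥ} p D≗E = Γ-cong is {ĝ = ĝ} {ĥ} p (applyWord-cong (p i) D≗E i)

Γ-congˡ : ∀ is ĝ {D E : SetSystem n} → D ≗ E → D Γ[ is ] ĝ ≗ E Γ[ is ] ĝ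
Γ-congˡ is ĝ = Γ-cong is {ĝ = ĝ} (λ _ → refl)

Γ-ε : ∀ is (D : SetSystem n) → D Γ[ is ] (λ _ → []) ≡ D
Γ-ε []       D = ≡.refl
Γ-ε (i ∷ is) D = Γ-ε is D

applyWord-Γ : ∀ w {i : Fin n} {is} → All (i ≢_) is → ∀ D ĝ →
  applyWord w D i Γ[ is ] ĝ ≗ applyWord w (D Γ[ is ] ĝ) i
applyWord-Γ w []           D ĝ X = ≡.refl
applyWord-Γ w {i} {j ∷ is} (i≢j ∷ i≢is) D ĝ X = ≡.trans
  (Γ-congˡ is ĝ (applyWord-comm (ĝ j) w D (i≢j ∘ ≡.sym)) X)
  (applyWord-Γ w i≢is (applyWord (ĝ j) D j) ĝ X)

-- Since `i` does not recur in the tail, `ĝ i` can be moved past all later `ĥ j`, separating the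
-- interleaved words into two passes.
Γ-∙ : ∀ {is : List (Fin n)} → Unique is → ∀ D ĝ ĥ →
  D Γ[ is ] (λ i → ĝ i ++ ĥ i) ≗ D Γ[ is ] ĥ Γ[ is ] ĝ
Γ-∙ []                        D ĝ ĥ X = ≡.refl
Γ-∙ {is = i ∷ is} (i∉is ∷ is!) D ĝ ĥ = begin
  applyWord (ĝ i ++ ĥ i) D i Γ[ is ] (λ i → ĝ i ++ ĥ i)
    ≡⟨ cong (_Γ[ is ] (λ i → ĝ i ++ ĥ i)) (applyWord-++ (ĝ i) (ĥ i) D i) ⟩
  applyWord (ĝ i) (applyWord (ĥ i) D i) i Γ[ is ] (λ i → ĝ i ++ ĥ i)
    ≈⟨ Γ-∙ is! _ ĝ ĥ ⟩
  applyWord (ĝ i) (applyWord (ĥ i) D i) i Γ[ is ] ĥ Γ[ is ] ĝ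
    ≈⟨ Γ-congˡ is ĝ (applyWord-Γ (ĝ i) i∉is _ ĥ) ⟩
  applyWord (ĝ i) (applyWord (ĥ i) D i Γ[ is ] ĥ) i Γ[ is ] ĝ ∎
  where open SetoidReasoning (SetSystems _)

Γ-↭ : ∀ {is js : List (Fin n)} → is ↭ js → ∀ D ĝ → D Γ[ is ] ĝ ≗ D Γ[ js ] ĝ
Γ-↭ ↭.refl         D ĝ X = ≡.refl
Γ-↭ (↭.prep i p)   D ĝ   = Γ-↭ p (applyWord (ĝ i) D i) ĝ
Γ-↭ (↭.trans p q)  D ĝ X = ≡.trans (Γ-↭ p D ĝ X) (Γ-↭ q D ĝ X)
Γ-↭ {js = _ ∷ _ ∷ js} (↭.swap i j p) D ĝ X = ≡.trans
  (Γ-↭ p _ ĝ X) (Γ-congˡ js ĝ swap X)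
  where
  swap : applyWord (ĝ j) (applyWord (ĝ i) D i) j ≗ applyWord (ĝ i) (applyWord (ĝ j) D j) i
  swap with i Fin.≟ j
  ... | yes ≡.refl = λ _ → ≡.refl
  ... | no  i≢j    = applyWord-comm (ĝ j) (ĝ i) D (i≢j ∘ ≡.sym)

-- Relabelling the ground set

-- Characteristic vectors pull back along `π`, so `permute π` becomes precomposition with this map.
preimage : Permutation′ n → Subset n → Subset n
preimage π X = tabulate λ i → lookup X (π ⟨$⟩ʳ i)

lookup-preimage : ∀ (π : Permutation′ n) X i → lookup (preimage π X) i ≡ lookup X (π ⟨$⟩ʳ i)
lookup-preimage π X i = lookup∘tabulate _ i

preimage-cong : ∀ {π ρ : Permutation′ n} → π Perm.≈ ρ → preimage π ≗ preimage ρ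
preimage-cong p X = tabulate-cong (cong (lookup X) ∘ p)

preimage-id : (X : Subset n) → preimage Perm.id X ≡ X
preimage-id = tabulate∘lookup

preimage-∘ₚ : ∀ (π ρ : Permutation′ n) X → preimage π (preimage ρ X) ≡ preimage (π ∘ₚ ρ) X
preimage-∘ₚ π ρ X = tabulate-cong λ i → lookup-preimage ρ X (π ⟨$⟩ʳ i)

preimage-flip : ∀ (π : Permutation′ n) X → preimage π (preimage (Perm.flip π) X) ≡ X
preimage-flip π X = ≡.trans (preimage-∘ₚ π (Perm.flip π) X)
  (≡.trans (preimage-cong {π = π ∘ₚ Perm.flip π} {Perm.id} (λ _ → Perm.inverseˡ π) X) (preimage-id X))

preimage-[]≔ : ∀ (π : Permutation′ n) X i b →
  preimage π (X [ π ⟨$⟩ʳ i ]≔ b) ≡ preimage π X [ i ]≔ b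
preimage-[]≔ π X i b = ≡.trans (tabulate-cong pointwise) (tabulate∘lookup _)
  where
  pointwise : ∀ j → lookup (X [ π ⟨$⟩ʳ i ]≔ b) (π ⟨$⟩ʳ j) ≡ lookup (preimage π X [ i ]≔ b) j
  pointwise j with j Fin.≟ i
  ... | yes ≡.refl = ≡.trans (lookup∘update _ X b) (≡.sym (lookup∘update i (preimage π X) b))
  ... | no  j≢i    = ≡.trans (lookup∘update′ (j≢i ∘ perm-injective π) X b)
    (≡.sym (≡.trans (lookup∘update′ j≢i (preimage π X) b) (lookup-preimage π X j)))

permuteSubset≗ : ∀ (π : Permutation′ n) → permuteSubset π ≗ preimage (Perm.flip π)
permuteSubset≗ π X = tabulate-cong λ j → does≡ (Fin.any? _)
  (λ { (i , i∈X , ≡.refl) → ≡.trans (cong (lookup X) (Perm.inverseˡ π)) ([]=⇒lookup i∈X) })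
  (λ p → π ⟨$⟩ˡ j , lookup⇒[]= _ X p , ≡.sym (Perm.inverseʳ π))

permute≗ : ∀ (π : Permutation′ n) D → permute π D ≗ D ∘ preimage π
permute≗ π = image-bijection
  (λ X → ≡.trans (cong (preimage π) (permuteSubset≗ π X)) (preimage-flip π X))
  (λ X → ≡.trans (permuteSubset≗ π (preimage π X)) (preimage-flip (Perm.flip π) X))

permute-cong : ∀ {π ρ : Permutation′ n} {D E} → π Perm.≈ ρ → D ≗ E → permute π D ≗ permute ρ E
permute-cong {π = π} {ρ} {D} {E} p D≗E X = begin
  permute π D X        ≡⟨ permute≗ π D X ⟩
  D (preimage π X)     ≡⟨ D≗E _ ⟩
  E (preimage π X)     ≡⟨ cong E (preimage-cong {π = π} {ρ} p X) ⟩
  E (preimage ρ X)     ≡⟨ permute≗ ρ E X ⟨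
  permute ρ E X        ∎
  where open ≡-Reasoning

permute-id : (D : SetSystem n) → permute Perm.id D ≗ D
permute-id D X = ≡.trans (permute≗ Perm.id D X) (cong D (preimage-id X))

-- `preimage` is contravariant and precomposing with it is contravariant again, which yields a left
-- action.
permute-∘ₚ : ∀ (π ρ : Permutation′ n) D → permute (ρ ∘ₚ π) D ≗ permute π (permute ρ D)
permute-∘ₚ π ρ D X = begin
  permute (ρ ∘ₚ π) D X           ≡⟨ permute≗ (ρ ∘ₚ π) D X ⟩
  D (preimage (ρ ∘ₚ π) X)        ≡⟨ cong D (preimage-∘ₚ ρ π X) ⟨
  D (preimage ρ (preimage π X))  ≡⟨ permute≗ ρ D (preimage π X) ⟨
  permute ρ D (preimage π X)     ≡⟨ permute≗ π (permute ρ D) X ⟨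
  permute π (permute ρ D) X      ∎
  where open ≡-Reasoning

-- The slice of `permute π D` at `X` in direction `π ⟨$⟩ʳ i` is the slice of `D` at `preimage π X`
-- in direction `i`.
permute-applyWord : ∀ (π : Permutation′ n) w D i →
  permute π (applyWord w D i) ≗ applyWord w (permute π D) (π ⟨$⟩ʳ i)
permute-applyWord π w D i X = begin
  permute π (applyWord w D i) X
    ≡⟨ permute≗ π (applyWord w D i) X ⟩
  applyWord w D i (preimage π X)
    ≡⟨ applyWord≗ w D i (preimage π X) ⟩
  actWord w (slice D (preimage π X) i) (lookup (preimage π X) i)
    ≡⟨ cong (actWord w _) (lookup-preimage π X i) ⟩
  actWord w (slice D (preimage π X) i) (lookup X (π ⟨$⟩ʳ i))
    ≡⟨ actWord-cong w (λ b → ≡.trans (permute≗ π D _) (cong D (preimage-[]≔ π X i b))) _ ⟨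
  actWord w (slice (permute π D) X (π ⟨$⟩ʳ i)) (lookup X (π ⟨$⟩ʳ i))
    ≡⟨ applyWord≗ w (permute π D) (π ⟨$⟩ʳ i) X ⟨
  applyWord w (permute π D) (π ⟨$⟩ʳ i) X ∎
  where open ≡-Reasoning

permute-Γ[] : ∀ (π : Permutation′ n) is D ĝ →
  permute π (D Γ[ is ] ĝ) ≗ permute π D Γ[ map (π ⟨$⟩ʳ_) is ] reindex π ĝ
permute-Γ[] π []       D ĝ X = ≡.refl
permute-Γ[] π (i ∷ is) D ĝ = begin
  permute π (applyWord (ĝ i) D i Γ[ is ] ĝ)
    ≈⟨ permute-Γ[] π is (applyWord (ĝ i) D i) ĝ ⟩
  permute π (applyWord (ĝ i) D i) Γ[ map (π ⟨$⟩ʳ_) is ] reindex π ĝ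
    ≈⟨ Γ-congˡ (map (π ⟨$⟩ʳ_) is) (reindex π ĝ) (permute-applyWord π (ĝ i) D i) ⟩
  applyWord (ĝ i) (permute π D) (π ⟨$⟩ʳ i) Γ[ map (π ⟨$⟩ʳ_) is ] reindex π ĝ
    -- `reindex π ĝ` at `π ⟨$⟩ʳ i` unfolds to `ĝ` at the inverse image of that point, which is only
    -- propositionally `i`.
    ≡⟨ cong (λ j → applyWord (ĝ j) (permute π D) (π ⟨$⟩ʳ i) Γ[ map (π ⟨$⟩ʳ_) is ] reindex π ĝ) (Perm.inverseˡ π) ⟨
  permute π D Γ[ map (π ⟨$⟩ʳ_) (i ∷ is) ] reindex π ĝ ∎
  where open SetoidReasoning (SetSystems _)

-- Both lists are duplicate-free and contain every element, so they agree as bags.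
map-allFin-↭ : (π : Permutation′ n) → map (π ⟨$⟩ʳ_) (allFin n) ↭ allFin n
map-allFin-↭ {n} π = ∼bag⇒↭ (unique∧set⇒bag
  (map⁺ (perm-injective π) (allFin⁺ n)) (allFin⁺ n)
  (λ {i} → mk⇔ (λ _ → ∈-allFin i)
    (λ _ → subst (_∈ map (π ⟨$⟩ʳ_) (allFin n)) (Perm.inverseʳ π) (∈-map⁺ (π ⟨$⟩ʳ_) (∈-allFin (π ⟨$⟩ˡ i))))))

-- Moving `π` inside visits the elements in the order given by `π`; `Γ-↭` restores the standard
-- order. This is the conjugation rule by which the actions of 𝓖ⁿ and Sₙ fit together along φ.
permute-Γ : ∀ (π : Permutation′ n) D ĝ → permute π (D Γ ĝ) ≗ permute π D Γ reindex π ĝ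
permute-Γ {n} π D ĝ X = ≡.trans (permute-Γ[] π (allFin n) D ĝ X)
  (Γ-↭ (map-allFin-↭ π) (permute π D) (reindex π ĝ) X)

-- The action of the semidirect product

semidirect-isLeftAction : ∀ n → IsLeftAction
  (semidirect (𝓖^ n) (Sym n) (λ π → reindex π , reindex-isAutomorphism π) reindex-isHom)
  (SetSystems n) (λ (ĝ , π) D → permute π D Γ ĝ)
semidirect-isLeftAction n = record
  { ▷-cong     = λ {(ĝ , π)} {(ĥ , ρ)} (ĝ≈ĥ , π≈ρ) D≗E →
      Γ-cong (allFin n) {ĝ = ĝ} {ĥ} ĝ≈ĥ (permute-cong {π = π} {ρ} π≈ρ D≗E)
  ; ▷-identity = λ D → begin
      permute Perm.id D Γ (λ _ → [])  ≡⟨ Γ-ε (allFin n) (permute Perm.id D) ⟩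
      permute Perm.id D               ≈⟨ permute-id D ⟩
      D                               ∎
  ; ▷-assoc    = λ (ĝ , π) (ĥ , ρ) D → begin
      permute (ρ ∘ₚ π) D Γ (λ i → ĝ i ++ reindex π ĥ i)
        ≈⟨ Γ-congˡ (allFin n) (λ i → ĝ i ++ reindex π ĥ i) (permute-∘ₚ π ρ D) ⟩
      permute π (permute ρ D) Γ (λ i → ĝ i ++ reindex π ĥ i)
        ≈⟨ Γ-∙ (allFin⁺ n) _ ĝ (reindex π ĥ) ⟩
      permute π (permute ρ D) Γ reindex π ĥ Γ ĝ
        ≈⟨ Γ-congˡ (allFin n) ĝ (permute-Γ π (permute ρ D) ĥ) ⟨
      permute π (permute ρ D Γ ĥ) Γ ĝ ∎
  }
  where open SetoidReasoning (SetSystems n)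

proposition3p1 : (n : ℕ) .{{_ : NonZero n}} →
    (𝓖 ≅ Sym 3) ×
    (Σ[ aut ∈ ((π : Permutation′ n) → IsAutomorphism (𝓖^ n) (reindex π)) ]
    Σ[ hom ∈ IsHom (Sym n) (Aut (𝓖^ n)) (λ π → reindex π , aut π) ]
    IsLeftAction
    (semidirect (𝓖^ n) (Sym n) (λ π → reindex π , aut π) hom)
    (SetSystems n)
    (λ (ĝ , π) D → permute π D Γ ĝ))
proposition3p1 n =
  (wordPerm , wordPerm-isIso) , reindex-isAutomorphism , reindex-isHom , semidirect-isLeftAction n
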